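{- Let $G=(V,E)$ be a finite directed acyclic graph. Then, with the minimum taken over all weak dominance drawings $\Gamma$ of $G$, $$\min_{\Gamma} fip(\Gamma)\ \le\ inc(G)-\left\lceil\frac{2\,inc(G)}{dim(G)}\right\rceil.$$
   Context: Let $G=(V,E)$ be a finite directed acyclic graph (dag). A topological sorting of $G$ is a bijection $t:V\to\{1,\dots,|V|\}$ such that $t(u)<t(v)$ for every edge $(u,v)\in E$. Weak dominance drawing: a (two-dimensional) weak dominance drawing $\Gamma$ of $G$ assigns to each vertex $u$ coordinates $(X(u),Y(u))$, where $X=t_X$ and $Y=t_Y$ are two (not necessarily distinct) topological sortings of $G$; in particular, if there is a directed path from $u$ to $v$ in $G$ then $X(u)\le X(v)$ and $Y(u)\le Y(v)$. Falsely implied paths: a falsely implied path (fip) of $\Gamma$ is an ordered pair $(u,v)$ of distinct vertices such that $X(u)\le X(v)$ and $Y(u)\le Y(v)$ but there is no directed path from $u$ to $v$ in $G$. The number of falsely implied paths of $\Gamma$ is denoted $fip(\Gamma)$. Incomparable pairs: $inc(G)$ is the number of unordered pairs $\{u,v\}$ of distinct vertices such that neither is reachable from the other by a directed path. Dimension: $dim(G)$ is the dominance drawing dimension of $G$, i.e. the smallest $k\ge 1$ for which a $k$-dimensional dominance drawing of $G$ exists; equivalently, the smallest $k\ge 1$ for which there are topological sortings $t_1,\dots,t_k$ of $G$ such that for all distinct $u,v\in V$ there is a directed path from $u$ to $v$ in $G$ if and only if $t_i(u)<t_i(v)$ for all $i=1,\dots,k$. -}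

module Defs where

open import Data.Empty using (⊥)
open import Data.Fin using (Fin; zero; suc; toℕ; fromℕ<; combine; remQuot; punchOut; finToFun; funToFin; _≤_; _<_)
open import Data.Fin.Induction using (spo-noetherian)
open import Data.Fin.Properties
  using (_≟_; _≤?_; _<?_; any?; all?; toℕ-fromℕ<; combine-monoˡ-<; combine-injectiveʳ; toℕ-injective;
         finToFun-funToFin; punchOut-injective; injective⇒≤; remQuot-combine; <⇒≢; <-asym)
open import Data.List using (List; []; _∷_; length; filter; allFin; cartesianProduct)
open import Data.List.Membership.Propositional using (_∈_)
open import Data.List.Membership.Propositional.Properties using (∈-allFin)
open import Data.List.Properties using (filter-≐; filter-notAll; length-tabulate)
open import Data.List.Relation.Unary.Any as Any using (here; there)
open import Data.Nat as ℕ using (ℕ; NonZero)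
open import Data.Nat.Induction using (<-rec)
import Data.Nat.Properties as ℕ
open import Data.Product using (∃; _×_; _,_; proj₁; proj₂)
open import Data.Sum using (_⊎_; inj₁; inj₂)
open import Function using (_∘_; id; _⇔_; mk⇔; Equivalence)
open import Function.Definitions using (Injective; Surjective; Bijective)
open import Induction.WellFounded using (Acc; acc)
open import Level using (0ℓ)
open import Relation.Binary using (Rel; Decidable; Transitive; tri<; tri≈; tri>)
open import Relation.Binary.Construct.Closure.Transitive using (TransClosure; [_]; _∷_; _++_)
open import Relation.Binary.PropositionalEquality
  using (_≡_; _≢_; _≗_; refl; sym; trans; cong; subst; subst₂; isEquivalence)
open import Relation.Nullary using (Dec; yes; no; ¬_; contradiction)
open import Relation.Nullary.Decidable using (map′; _×-dec_; _⊎-dec_; _→-dec_; ¬?; decidable-stable)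
open import Relation.Unary as U using (Pred)

record Dag (n : ℕ) : Set₁ where
  field
    Edge    : Rel (Fin n) 0ℓ
    edge?   : Decidable Edge
    acyclic : ∀ u → ¬ TransClosure Edge u u

  -- Nonempty directed paths; the empty path never matters below, since only
  -- paths between distinct vertices are considered.
  Path : Rel (Fin n) 0ℓ
  Path = TransClosure Edge

-- Positions are numbered 0, …, n - 1 instead of 1, …, n.
record TopologicalSorting {n : ℕ} (G : Dag n) : Set where
  open Dag G
  field
    rank      : Fin n → Fin n
    bijective : Bijective _≡_ _≡_ rank
    monotone  : ∀ {u v} → Edge u v → rank u < rank v

open TopologicalSorting public using (rank)

record WeakDominanceDrawing {n : ℕ} (G : Dag n) : Set where
  constructor drawing
  field
    t-X t-Y : TopologicalSorting G

  X Y : Fin n → Fin n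
  X = rank t-X
  Y = rank t-Y

record DominanceDrawing {n : ℕ} (G : Dag n) (k : ℕ) : Set where
  open Dag G
  field
    sorting : Fin k → TopologicalSorting G
    path⇔<  : ∀ {u v} → u ≢ v → Path u v ⇔ (∀ i → rank (sorting i) u < rank (sorting i) v)

FalselyImplied : ∀ {n} {G : Dag n} → WeakDominanceDrawing G → Pred (Fin n × Fin n) 0ℓ
FalselyImplied {G = G} Γ (u , v) = u ≢ v × X u ≤ X v × Y u ≤ Y v × ¬ Dag.Path G u v
  where open WeakDominanceDrawing Γ

Incomparable : ∀ {n} → Dag n → Pred (Fin n × Fin n) 0ℓ
Incomparable G (u , v) = u ≢ v × ¬ Dag.Path G u v × ¬ Dag.Path G v u

Least : Pred ℕ 0ℓ → Pred ℕ 0ℓ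
Least P k = P k × (∀ {j} → P j → k ℕ.≤ j)

path? : ∀ {n} (G : Dag n) → Decidable (Dag.Path G)
path? {n} G u v = go u (spo-noetherian isSPO u)
  where
  open Dag G
  isSPO = record
    { isEquivalence = isEquivalence
    ; irrefl        = λ { refl → acyclic _ }
    ; trans         = _++_
    ; <-resp-≈      = (λ { refl p → p }) , (λ { refl p → p })
    }

  go : ∀ x → Acc (λ y z → Path z y) x → Dec (Path x v)
  go x (acc rec) = map′ to from (any? step?)
    where
    Step : Fin n → Set
    Step w = Edge x w × (w ≡ v ⊎ Path w v)

    step? : U.Decidable Step
    step? w with edge? x w
    ... | no ¬e = no (¬e ∘ proj₁)
    ... | yes e = map′ (e ,_) proj₂ (w ≟ v ⊎-dec go w (rec [ e ]))

    to : ∃ Step → Path x v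
    to (w , e , inj₁ refl) = [ e ]
    to (w , e , inj₂ p)    = e ∷ p

    from : Path x v → ∃ Step
    from [ e ]   = v , e , inj₁ refl
    from (e ∷ p) = _ , e , inj₂ p

falselyImplied? : ∀ {n} {G : Dag n} (Γ : WeakDominanceDrawing G) → U.Decidable (FalselyImplied Γ)
falselyImplied? {G = G} Γ (u , v) =
  ¬? (u ≟ v) ×-dec X u ≤? X v ×-dec Y u ≤? Y v ×-dec ¬? (path? G u v)
  where open WeakDominanceDrawing Γ

incomparable? : ∀ {n} (G : Dag n) → U.Decidable (Incomparable G)
incomparable? G (u , v) = ¬? (u ≟ v) ×-dec ¬? (path? G u v) ×-dec ¬? (path? G v u)

orderedPairs : ∀ n → List (Fin n × Fin n)
orderedPairs n = cartesianProduct (allFin n) (allFin n)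

-- An unordered pair of distinct vertices {u , v} is represented by the
-- ordered pair with u < v as elements of Fin n.
unorderedPairs : ∀ n → List (Fin n × Fin n)
unorderedPairs n = filter (λ (u , v) → u <? v) (orderedPairs n)

fip : ∀ {n} {G : Dag n} → WeakDominanceDrawing G → ℕ
fip {n} Γ = length (filter (falselyImplied? Γ) (orderedPairs n))

inc : ∀ {n} → Dag n → ℕ
inc {n} G = length (filter (incomparable? G) (unorderedPairs n))

private
  findLeast : ∀ {P : Pred ℕ 0ℓ} → U.Decidable P → ∀ k → P k → ∃ (Least P)
  findLeast {P} P? = <-rec (λ k → P k → ∃ (Least P)) step
    where
    step : ∀ k → (∀ {j} → j ℕ.< k → P j → ∃ (Least P)) → P k → ∃ (Least P)
    step k rec pk with ℕ.anyUpTo? P? k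
    ... | yes (j , j<k , pj) = rec j<k pj
    ... | no ¬smaller = k , pk , λ pj → ℕ.≮⇒≥ (λ j<k → ¬smaller (_ , j<k , pj))

  injective⇒surjective : ∀ {n} {f : Fin n → Fin n} → Injective _≡_ _≡_ f → Surjective _≡_ _≡_ f
  injective⇒surjective {n} {f} inj y with any? (λ x → f x ≟ y)
  ... | yes (x , fx≡y) = x , λ { refl → fx≡y }
  ... | no ∄x = contradiction (missed inj y (λ x y≡fx → ∄x (x , sym y≡fx))) λ ()
    where
    missed : ∀ {n} {f : Fin n → Fin n} → Injective _≡_ _≡_ f → ∀ y → (∀ x → y ≢ f x) → ⊥
    missed {ℕ.suc n} inj y y≢ =
      ℕ.1+n≰n (injective⇒≤ {f = λ x → punchOut (y≢ x)}
        (λ {a} {b} eq → inj (punchOut-injective (y≢ a) (y≢ b) eq)))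

  filter-length-mono : ∀ {A : Set} {P Q : Pred A 0ℓ} (P? : U.Decidable P) (Q? : U.Decidable Q) →
                       (∀ {x} → P x → Q x) → ∀ xs → length (filter P? xs) ℕ.≤ length (filter Q? xs)
  filter-length-mono P? Q? P⇒Q [] = ℕ.z≤n
  filter-length-mono P? Q? P⇒Q (x ∷ xs) with P? x | Q? x | filter-length-mono P? Q? P⇒Q xs
  ... | yes _ | yes _ | r = ℕ.s≤s r
  ... | yes p | no ¬q | r = contradiction (P⇒Q p) ¬q
  ... | no _  | yes _ | r = ℕ.m≤n⇒m≤1+n r
  ... | no _  | no _  | r = r

  filter-length-strict : ∀ {A : Set} {P Q : Pred A 0ℓ} (P? : U.Decidable P) (Q? : U.Decidable Q) →
                         (∀ {x} → P x → Q x) → ∀ {y xs} → y ∈ xs → ¬ P y → Q y →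
                         length (filter P? xs) ℕ.< length (filter Q? xs)
  filter-length-strict P? Q? P⇒Q {xs = x ∷ xs} (here refl) ¬p q with P? x | Q? x
  ... | yes p | _     = contradiction p ¬p
  ... | no _  | yes _ = ℕ.s≤s (filter-length-mono P? Q? P⇒Q xs)
  ... | no _  | no ¬q = contradiction q ¬q
  filter-length-strict P? Q? P⇒Q {xs = x ∷ xs} (there y∈) ¬p q
    with P? x | Q? x | filter-length-strict P? Q? P⇒Q y∈ ¬p q
  ... | yes _ | yes _ | r = ℕ.s≤s r
  ... | yes p | no ¬q | r = contradiction (P⇒Q p) ¬q
  ... | no _  | yes _ | r = ℕ.m≤n⇒m≤1+n r
  ... | no _  | no _  | r = r

  -- Every injective key k : Fin n → ℕ is order-equivalent to a permutation.
  module Ranking {n : ℕ} (key : Fin n → ℕ) (key-injective : Injective _≡_ _≡_ key) where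
    below? : ∀ u → U.Decidable (λ w → key w ℕ.< key u)
    below? u w = key w ℕ.<? key u

    position : Fin n → ℕ
    position u = length (filter (below? u) (allFin n))

    position-< : ∀ u → position u ℕ.< n
    position-< u = subst (position u ℕ.<_) (length-tabulate id)
      (filter-notAll (below? u) (allFin n) (Any.map (λ { refl → ℕ.<-irrefl refl }) (∈-allFin u)))

    ranking : Fin n → Fin n
    ranking u = fromℕ< (position-< u)

    ranking-mono : ∀ {u v} → key u ℕ.< key v → ranking u < ranking v
    ranking-mono {u} {v} u<v = subst₂ ℕ._<_ (sym (toℕ-fromℕ< _)) (sym (toℕ-fromℕ< _))
      (filter-length-strict (below? u) (below? v) (λ w<u → ℕ.<-trans w<u u<v) (∈-allFin u) (ℕ.<-irrefl refl) u<v)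

    ranking-injective : Injective _≡_ _≡_ ranking
    ranking-injective {u} {v} eq with ℕ.<-cmp (key u) (key v)
    ... | tri< u<v _ _ = contradiction eq (<⇒≢ (ranking-mono u<v))
    ... | tri≈ _ u≡v _ = key-injective u≡v
    ... | tri> _ _ v<u = contradiction (sym eq) (<⇒≢ (ranking-mono v<u))

  -- Linear extension: order vertices by the number of their predecessors,
  -- breaking ties by index.
  linearExtension : ∀ {n} {_⊏_ : Rel (Fin n) 0ℓ} → Decidable _⊏_ → Transitive _⊏_ → (∀ u → ¬ (u ⊏ u)) →
                    ∃ λ (f : Fin n → Fin n) → Bijective _≡_ _≡_ f × (∀ {u v} → u ⊏ v → f u < f v)
  linearExtension {n} {_⊏_} _⊏?_ ⊏-trans ⊏-irrefl =
    ranking , (ranking-injective , injective⇒surjective ranking-injective) , ranking-mono ∘ key-mono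
    where
    bound : ∀ u → length (filter (_⊏? u) (allFin n)) ℕ.< n
    bound u = subst (length (filter (_⊏? u) (allFin n)) ℕ.<_) (length-tabulate id)
      (filter-notAll (_⊏? u) (allFin n) (Any.map (λ { refl → ⊏-irrefl u }) (∈-allFin u)))

    height : Fin n → Fin n
    height u = fromℕ< (bound u)

    key : Fin n → ℕ
    key u = toℕ (combine (height u) u)

    key-injective : Injective _≡_ _≡_ key
    key-injective {u} {v} eq = combine-injectiveʳ (height u) u (height v) v (toℕ-injective eq)

    key-mono : ∀ {u v} → u ⊏ v → key u ℕ.< key v
    key-mono {u} {v} u⊏v = combine-monoˡ-< {i = height u} {j = height v} u v
      (subst₂ ℕ._<_ (sym (toℕ-fromℕ< _)) (sym (toℕ-fromℕ< _))
        (filter-length-strict (_⊏? u) (_⊏? v) (λ w⊏u → ⊏-trans w⊏u u⊏v) (∈-allFin u) (⊏-irrefl u) u⊏v))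

    open Ranking key key-injective

  module _ {n : ℕ} (G : Dag n) where
    open Dag G

    path⇒< : (t : TopologicalSorting G) → ∀ {u v} → Path u v → rank t u < rank t v
    path⇒< t [ e ]   = TopologicalSorting.monotone t e
    path⇒< t (e ∷ p) = ℕ.<-trans (TopologicalSorting.monotone t e) (path⇒< t p)

    someSorting : TopologicalSorting G
    someSorting with f , bij , mono ← linearExtension (path? G) _++_ acyclic =
      record { rank = f ; bijective = bij ; monotone = λ e → mono [ e ] }

    sortingWith : ∀ {a b} → Incomparable G (a , b) → ∃ λ (t : TopologicalSorting G) → rank t a < rank t b
    sortingWith {a} {b} (a≢b , ¬ab , ¬ba) =
      let f , bij , mono = linearExtension ⊏? ⊏-trans ⊏-irrefl in
      record { rank = f ; bijective = bij ; monotone = λ e → mono (inj₁ [ e ]) }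
      , mono (inj₂ (inj₁ refl , inj₁ refl))
      where
      _⊑_ _⊏_ : Rel (Fin n) 0ℓ
      x ⊑ y = x ≡ y ⊎ Path x y
      x ⊏ y = Path x y ⊎ (x ⊑ a × b ⊑ y)

      ⊑? : Decidable _⊑_
      ⊑? x y = x ≟ y ⊎-dec path? G x y

      ⊏? : Decidable _⊏_
      ⊏? x y = path? G x y ⊎-dec (⊑? x a ×-dec ⊑? b y)

      ⊑-trans : Transitive _⊑_
      ⊑-trans (inj₁ refl) q = q
      ⊑-trans (inj₂ p) (inj₁ refl) = inj₂ p
      ⊑-trans (inj₂ p) (inj₂ q) = inj₂ (p ++ q)

      b⋢a : ¬ (b ⊑ a)
      b⋢a (inj₁ b≡a) = a≢b (sym b≡a)
      b⋢a (inj₂ p)   = ¬ba p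

      ⊏-trans : Transitive _⊏_
      ⊏-trans (inj₁ p) (inj₁ q) = inj₁ (p ++ q)
      ⊏-trans (inj₁ p) (inj₂ (y⊑a , b⊑z)) = inj₂ (⊑-trans (inj₂ p) y⊑a , b⊑z)
      ⊏-trans (inj₂ (x⊑a , b⊑y)) (inj₁ q) = inj₂ (x⊑a , ⊑-trans b⊑y (inj₂ q))
      ⊏-trans (inj₂ (_ , b⊑y)) (inj₂ (y⊑a , _)) = contradiction (⊑-trans b⊑y y⊑a) b⋢a

      ⊏-irrefl : ∀ u → ¬ (u ⊏ u)
      ⊏-irrefl u (inj₁ p) = acyclic u p
      ⊏-irrefl u (inj₂ (u⊑a , b⊑u)) = b⋢a (⊑-trans b⊑u u⊑a)

    -- One sorting for each ordered pair of vertices, and one more.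
    someDominanceDrawing : DominanceDrawing G (ℕ.suc (n ℕ.* n))
    someDominanceDrawing = record { sorting = family ; path⇔< = λ u≢v → mk⇔ (λ p i → path⇒< (family i) p) (from u≢v) }
      where
      separate : Fin n × Fin n → TopologicalSorting G
      separate (u , v) with incomparable? G (u , v)
      ... | yes u∥v = proj₁ (sortingWith u∥v)
      ... | no _    = someSorting

      separate-< : ∀ u v → Incomparable G (u , v) → rank (separate (u , v)) u < rank (separate (u , v)) v
      separate-< u v u∥v with incomparable? G (u , v)
      ... | yes u∥v′ = proj₂ (sortingWith u∥v′)
      ... | no ¬u∥v  = contradiction u∥v ¬u∥v

      family : Fin (ℕ.suc (n ℕ.* n)) → TopologicalSorting G
      family zero    = someSorting
      family (suc i) = separate (remQuot n i)

      from : ∀ {u v} → u ≢ v → (∀ i → rank (family i) u < rank (family i) v) → Path u v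
      from {u} {v} u≢v all< = decidable-stable (path? G u v) λ ¬uv →
        let ¬vu  = λ p → <-asym (all< zero) (path⇒< someSorting p)
            v<u  = separate-< v u (u≢v ∘ sym , ¬vu , ¬uv)
            u<v  = subst (λ p → rank (separate p) u < rank (separate p) v)
                     (remQuot-combine v u) (all< (suc (combine v u)))
        in <-asym u<v v<u

    sorting? : (f : Fin n → Fin n) → Dec (Bijective _≡_ _≡_ f × (∀ {u v} → Edge u v → f u < f v))
    sorting? f = map′ (λ (inj , mono) → ((λ {u} {v} → inj u v) , injective⇒surjective (λ {u} {v} → inj u v)) , (λ {u} {v} → mono u v))
                      (λ (bij , mono) → (λ u v → proj₁ bij) , (λ u v → mono))
                      (all? (λ u → all? (λ v → (f u ≟ f v) →-dec (u ≟ v)))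
                       ×-dec all? (λ u → all? (λ v → edge? u v →-dec (f u <? f v))))

    -- Topological sortings are searched through the finitely many functions
    -- Fin n → Fin n, hence the predicate must respect pointwise equality.
    searchSorting : {P : Pred (TopologicalSorting G) 0ℓ} → (∀ {s t} → rank s ≗ rank t → P s → P t) →
                    U.Decidable P → Dec (∃ P)
    searchSorting {P} resp P? = map′ to from (any? try)
      where
      Try : Fin (n ℕ.^ n) → Set
      Try c = ∃ λ t → rank t ≗ finToFun c × P t

      try : U.Decidable Try
      try c with sorting? (finToFun c)
      ... | no ¬s = no λ (t , eq , _) → ¬s
        ( ( (λ {u} {v} e → proj₁ (TopologicalSorting.bijective t) (trans (eq u) (trans e (sym (eq v)))))
          , (λ y → let (x , fx) = proj₂ (TopologicalSorting.bijective t) y in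
                   x , λ { refl → trans (sym (eq x)) (fx refl) }) )
        , λ {u} {v} e → subst₂ _<_ (eq u) (eq v) (TopologicalSorting.monotone t e))
      ... | yes (bij , mono) =
        let t = record { rank = finToFun c ; bijective = bij ; monotone = mono } in
        map′ (λ p → t , (λ _ → refl) , p) (λ (_ , eq , p) → resp eq p) (P? t)

      to : ∃ Try → ∃ P
      to (_ , t , _ , p) = t , p

      from : ∃ P → ∃ Try
      from (t , p) = funToFin (rank t) , t , (λ u → sym (finToFun-funToFin (rank t) u)) , p

    searchFamily : ∀ k {P : Pred (Fin k → TopologicalSorting G) 0ℓ} →
                   (∀ {s t} → (∀ i → rank (s i) ≗ rank (t i)) → P s → P t) → U.Decidable P → Dec (∃ P)
    searchFamily ℕ.zero resp P? = map′ (none ,_) (λ (_ , p) → resp (λ ()) p) (P? none)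
      where
      none : Fin 0 → TopologicalSorting G
      none ()
    searchFamily (ℕ.suc k) {P} resp P? = map′
      (λ (t , ts , p) → cons t ts , p)
      (λ (ts , p) → ts zero , ts ∘ suc , resp (λ { zero _ → refl ; (suc i) _ → refl }) p)
      (searchSorting (λ eq (ts , p) → ts , resp (λ { zero → eq ; (suc i) _ → refl }) p)
        (λ t → searchFamily k (λ eq → resp (λ { zero _ → refl ; (suc i) → eq i })) (λ ts → P? (cons t ts))))
      where
      cons : TopologicalSorting G → (Fin k → TopologicalSorting G) → Fin (ℕ.suc k) → TopologicalSorting G
      cons t ts zero    = t
      cons t ts (suc i) = ts i

    dominanceDrawing? : U.Decidable (DominanceDrawing G)
    dominanceDrawing? k = map′
      (λ (ts , h) → record { sorting = ts ; path⇔< = λ {u} {v} u≢v → mk⇔ (λ p i → path⇒< (ts i) p) (h u v u≢v) })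
      (λ D → DominanceDrawing.sorting D , λ u v u≢v → Equivalence.from (DominanceDrawing.path⇔< D u≢v))
      (searchFamily k
        (λ eq h u v u≢v all< → h u v u≢v (λ i → subst₂ _<_ (sym (eq i u)) (sym (eq i v)) (all< i)))
        (λ ts → all? λ u → all? λ v → ¬? (u ≟ v) →-dec
          (all? (λ i → rank (ts i) u <? rank (ts i) v) →-dec path? G u v)))

    fip-cong : ∀ {s s′ t t′ : TopologicalSorting G} → rank s ≗ rank s′ → rank t ≗ rank t′ →
               fip (drawing s t) ≡ fip (drawing s′ t′)
    fip-cong {s} {s′} {t} {t′} eqX eqY =
      cong length (filter-≐ (falselyImplied? (drawing s t)) (falselyImplied? (drawing s′ t′))
        ( (λ {(u , v)} (u≢v , x , y , ¬p) → u≢v , subst₂ _≤_ (eqX u) (eqX v) x , subst₂ _≤_ (eqY u) (eqY v) y , ¬p)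
        , (λ {(u , v)} (u≢v , x , y , ¬p) →
            u≢v , subst₂ _≤_ (sym (eqX u)) (sym (eqX v)) x , subst₂ _≤_ (sym (eqY u)) (sym (eqY v)) y , ¬p))
        (orderedPairs n))

    fipValue? : U.Decidable (λ m → ∃ λ (Γ : WeakDominanceDrawing G) → fip Γ ≡ m)
    fipValue? m = map′ (λ (s , t , e) → drawing s t , e) (λ { (drawing s t , e) → s , t , e })
      (searchSorting (λ {s} {s′} eq (t , e) → t , trans (sym (fip-cong {s} {s′} {t} {t} eq (λ _ → refl))) e)
        (λ s → searchSorting (λ {t} {t′} eq e → trans (sym (fip-cong {s} {s} {t} {t′} (λ _ → refl) eq)) e)
          (λ t → fip (drawing s t) ℕ.≟ m)))

abstract
  dimension : ∀ {n} (G : Dag n) → ∃ (Least (λ k → 1 ℕ.≤ k × DominanceDrawing G k))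
  dimension {n} G = findLeast (λ k → 1 ℕ.≤? k ×-dec dominanceDrawing? G k)
    (ℕ.suc (n ℕ.* n)) (ℕ.s≤s ℕ.z≤n , someDominanceDrawing G)

  minimumFip : ∀ {n} (G : Dag n) → ∃ (Least (λ m → ∃ λ (Γ : WeakDominanceDrawing G) → fip Γ ≡ m))
  minimumFip G = findLeast (fipValue? G) _ (drawing (someSorting G) (someSorting G) , refl)

dim : ∀ {n} → Dag n → ℕ
dim G = proj₁ (dimension G)

min-fip : ∀ {n} → Dag n → ℕ
min-fip G = proj₁ (minimumFip G)

instance
  dim-nonZero : ∀ {n} {G : Dag n} → NonZero (dim G)
  dim-nonZero {G = G} = ℕ.>-nonZero (proj₁ (proj₁ (proj₂ (dimension G))))

-- Order a realizer t₁, …, tₖ cyclically and go once around it. An incomparable pair is ordered both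
-- ways by the realizer, so its order flips at least twice on the way; the k steps thus contain at
-- least 2 inc(G) flips in total. The drawing (tᵢ , tᵢ₊₁) has a falsely implied path exactly for each
-- incomparable pair that does not flip, so each step contains at most inc(G) - min fip flips. Hence
-- 2 inc(G) ≤ k (inc(G) - min fip).

module Submission where

open import Defs
open import Data.Nat using (ℕ; _*_)
open import Data.Integer using (+_; _-_; _≤_)
open import Data.Rational using (_/_; ceiling)
open import Algebra.Properties.CommutativeSemigroup using (interchange)
open import Data.Bool using (Bool; true; false)
open import Data.Fin as Fin using (Fin; zero; suc)
import Data.Fin.Properties as Fin
import Data.Integer as ℤ
import Data.Integer.DivMod as ℤ
import Data.Integer.Properties as ℤ
open import Data.List using (List; []; _∷_; _++_; length; filter; map; tabulate)
open import Data.List.Membership.Propositional using (_∈_)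
open import Data.List.Membership.Propositional.Properties
  using (∈-allFin; ∈-cartesianProduct⁺; ∈-filter⁺; ∈-filter⁻; ∈-map⁺; ∈-++⁺ˡ; ∈-++⁺ʳ; ∈-++⁻; ∈-tabulate⁺; ∈-∃++)
open import Data.List.Properties using (length-++; length-map; length-tabulate)
open import Data.List.Relation.Binary.Subset.Propositional using (_⊆_)
open import Data.List.Relation.Unary.All as All using (All; []; _∷_)
open import Data.List.Relation.Unary.Any using (here; there)
open import Data.List.Relation.Unary.AllPairs using ([]; _∷_)
open import Data.List.Relation.Unary.Unique.Propositional using (Unique)
import Data.List.Relation.Unary.Unique.Propositional.Properties as Unique
open import Data.Nat as ℕ using (_+_; _∸_; z≤n; s≤s; NonZero)
open import Data.Nat.ListAction using (sum)
import Data.Nat.Properties as ℕ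
open import Data.Product using (∃; _×_; _,_; proj₁; proj₂; swap)
import Data.Rational as ℚ
import Data.Rational.Properties as ℚ
import Data.Rational.Unnormalised as ℚᵘ
import Data.Rational.Unnormalised.Properties as ℚᵘ
open import Data.Sum using (inj₁; inj₂)
open import Function using (_∘_; Equivalence)
open import Level using (0ℓ)
open import Relation.Binary using (tri<; tri≈; tri>)
open import Relation.Binary.Construct.Closure.Transitive using ([_]; _∷_)
open import Relation.Binary.PropositionalEquality using (_≡_; _≢_; refl; sym; trans; cong; cong₂; subst)
open import Relation.Nullary using (yes; no; ¬_; does; contradiction)
open import Relation.Nullary.Decidable using (dec-true; dec-false)
open import Relation.Unary as U using (Pred)

-- Upper bounds on ceilings of fractions.

⌈/⌉-≤ : ∀ i k .{{_ : NonZero k}} j → i ≤ j ℤ.* + k → ⌈ i / k ⌉ ≤ j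
⌈/⌉-≤ i k@(ℕ.suc _) j i≤jk = ceiling-≤ (i / k)
  -- `i / k` is kept in lowest terms, so it is exchanged for the unreduced fraction, where
  -- cross-multiplication gives back the hypothesis.
  (ℚᵘ.≤-trans (ℚᵘ.≤-reflexive (ℚ.toℚᵘ-fromℚᵘ (i ℚᵘ./ k)))
    (ℚᵘ.*≤* (subst (_≤ j ℤ.* + k) (sym (ℤ.*-identityʳ i)) i≤jk)))
  where
  -- Division with remainder gives `↥ q < suc (floor q) * ↧ q`; cancelling the positive denominator
  -- leaves `l < suc (floor q)`.
  floor-≥ : ∀ q l → l ℤ.* ℚ.↧ q ≤ ℚ.↥ q → l ≤ ℚ.floor q
  floor-≥ q@record{} l l*d≤n = subst (l ≤_) (trans (ℤ.pred-suc m) (sym (ℤ.div-pos-is-/ℕ (ℚ.↥ q) (ℚ.↧ₙ q))))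
    (ℤ.i<j⇒i≤pred[j] (ℤ.*-cancelʳ-<-nonNeg {l} {ℤ.suc m} (ℚ.↧ q)
      (ℤ.≤-<-trans l*d≤n (ℤ.n<s[n/ℕd]*d (ℚ.↥ q) (ℚ.↧ₙ q)))))
    where m = ℚ.↥ q ℤ./ℕ ℚ.↧ₙ q

  -- `⌈ p ⌉` unfolds to `- floor (- p)`, which turns the claim into `floor-≥` for `- p` and `- j`.
  ceiling-≤ : ∀ p → ℚ.toℚᵘ p ℚᵘ.≤ j ℚᵘ./ 1 → ⌈ p ⌉ ≤ j
  ceiling-≤ p@record{} (ℚᵘ.*≤* n*1≤j*d) =
    subst (⌈ p ⌉ ≤_) (ℤ.neg-involutive j) (ℤ.neg-mono-≤ (floor-≥ (ℚ.- p) (ℤ.- j) -j*d≤-n))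
    where
    open ℤ.≤-Reasoning
    -j*d≤-n : ℤ.- j ℤ.* ℚ.↧ (ℚ.- p) ≤ ℚ.↥ (ℚ.- p)
    -j*d≤-n = begin
      ℤ.- j ℤ.* ℚ.↧ (ℚ.- p)    ≡⟨ cong (ℤ.- j ℤ.*_) (ℚ.↧-neg p) ⟩
      ℤ.- j ℤ.* ℚ.↧ p          ≡⟨ ℤ.neg-distribˡ-* j (ℚ.↧ p) ⟨
      ℤ.- (j ℤ.* ℚ.↧ p)        ≤⟨ ℤ.neg-mono-≤ n*1≤j*d ⟩
      ℤ.- (ℚ.↥ p ℤ.* ℤ.1ℤ)     ≡⟨ cong ℤ.-_ (ℤ.*-identityʳ (ℚ.↥ p)) ⟩
      ℤ.- ℚ.↥ p                ≡⟨ ℚ.↥-neg p ⟨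
      ℚ.↥ (ℚ.- p)              ∎

-- Counting elements of lists.

unique-⊆⇒length-≤ : ∀ {A : Set} {xs ys : List A} → Unique xs → xs ⊆ ys → length xs ℕ.≤ length ys
unique-⊆⇒length-≤ [] _ = z≤n
-- Cut one occurrence of `x` out of `ys`: the tail `xs` avoids `x`, so it still lies in what
-- remains.
unique-⊆⇒length-≤ {xs = x ∷ xs} (x∉xs ∷ xs!) xs⊆ys with ys₁ , ys₂ , refl ← ∈-∃++ (xs⊆ys (here refl)) = begin
  ℕ.suc (length xs)                  ≤⟨ s≤s (unique-⊆⇒length-≤ xs! xs⊆ys₁++ys₂) ⟩
  ℕ.suc (length (ys₁ ++ ys₂))        ≡⟨ cong ℕ.suc (length-++ ys₁) ⟩
  ℕ.suc (length ys₁ + length ys₂)    ≡⟨ ℕ.+-suc (length ys₁) (length ys₂) ⟨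
  length ys₁ + length (x ∷ ys₂)      ≡⟨ length-++ ys₁ ⟨
  length (ys₁ ++ x ∷ ys₂)            ∎
  where
  open ℕ.≤-Reasoning
  xs⊆ys₁++ys₂ : xs ⊆ ys₁ ++ ys₂
  xs⊆ys₁++ys₂ z∈xs with ∈-++⁻ ys₁ (xs⊆ys (there z∈xs))
  ... | inj₁ z∈ys₁         = ∈-++⁺ˡ z∈ys₁
  ... | inj₂ (here refl)   = contradiction refl (All.lookup x∉xs z∈xs)
  ... | inj₂ (there z∈ys₂) = ∈-++⁺ʳ ys₁ z∈ys₂

module _ {A : Set} {P Q : Pred A 0ℓ} (P? : U.Decidable P) (Q? : U.Decidable Q) (f : A → ℕ)
         (P⇒¬Q : ∀ {x} → P x → ¬ Q x) (f≤1 : ∀ x → f x ℕ.≤ 1)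
         (P⇒f≡0 : ∀ {x} → P x → f x ≡ 0) (Q⇒f≡0 : ∀ {x} → Q x → f x ≡ 0) where

  -- Each element is charged at most once: it passes at most one of the filters, and if it passes
  -- one, its summand is 0.
  filters+sum≤length : ∀ xs → (length (filter P? xs) + length (filter Q? xs)) + sum (map f xs) ℕ.≤ length xs
  filters+sum≤length [] = z≤n
  filters+sum≤length (x ∷ xs) with P? x | Q? x | filters+sum≤length xs
  ... | yes p | yes q | _   = contradiction q (P⇒¬Q p)
  ... | yes p | no _  | rec rewrite P⇒f≡0 p = s≤s rec
  ... | no _  | yes q | rec rewrite Q⇒f≡0 q | ℕ.+-suc (length (filter P? xs)) (length (filter Q? xs)) = s≤s rec
  ... | no _  | no _  | rec = begin
    m + (f x + sum (map f xs))  ≡⟨ x∙yz≈y∙xz m (f x) (sum (map f xs)) ⟩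
    f x + (m + sum (map f xs))  ≤⟨ ℕ.+-mono-≤ (f≤1 x) rec ⟩
    ℕ.suc (length xs)           ∎
    where
    open ℕ.≤-Reasoning
    open import Algebra.Properties.CommutativeSemigroup ℕ.+-commutativeSemigroup using (x∙yz≈y∙xz)
    m = length (filter P? xs) + length (filter Q? xs)

-- Lengths of walks with a fixed endpoint.

walkTo : ∀ {A : Set} (a : A) → (A → A → ℕ) → A → List A → ℕ
walkTo a d x []       = d x a
walkTo a d x (y ∷ ys) = d x y + walkTo a d y ys

module _ {A : Set} {a : A} where

  walkTo-+ : ∀ (d e : A → A → ℕ) x ys →
             walkTo a (λ y z → d y z + e y z) x ys ≡ walkTo a d x ys + walkTo a e x ys
  walkTo-+ d e x []       = refl
  walkTo-+ d e x (y ∷ ys) = trans (cong (λ w → d x y + e x y + w) (walkTo-+ d e y ys))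
    (interchange ℕ.+-commutativeSemigroup (d x y) (e x y) _ _)

  module _ {d : A → A → ℕ} where

    -- With `length ys` intermediate stops there is one step more, the last one leading to `a`.
    walkTo-≤ : ∀ {m} → (∀ x y → d x y ℕ.≤ m) → ∀ x ys → walkTo a d x ys ℕ.≤ ℕ.suc (length ys) * m
    walkTo-≤ {m} d≤m x []       = ℕ.≤-trans (d≤m x a) (ℕ.m≤m+n m 0)
    walkTo-≤ d≤m x (y ∷ ys) = ℕ.+-mono-≤ (d≤m x y) (walkTo-≤ d≤m y ys)

    module _ (triangle : ∀ x y z → d x z ℕ.≤ d x y + d y z) where
      open ℕ.≤-Reasoning

      walkTo-≥ : ∀ x ys → d x a ℕ.≤ walkTo a d x ys
      walkTo-≥ x []       = ℕ.≤-refl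
      walkTo-≥ x (y ∷ ys) = ℕ.≤-trans (triangle x y a) (ℕ.+-monoʳ-≤ (d x y) (walkTo-≥ y ys))

      -- By the triangle inequality, skipping every intermediate stop except `y` cannot lengthen the
      -- walk.
      walkTo-via-≥ : ∀ x {y ys} → y ∈ ys → d x y + d y a ℕ.≤ walkTo a d x ys
      walkTo-via-≥ x {y} {_ ∷ ys} (here refl) = ℕ.+-monoʳ-≤ (d x y) (walkTo-≥ y ys)
      walkTo-via-≥ x {y} {z ∷ ys} (there y∈ys) = begin
        d x y + d y a            ≤⟨ ℕ.+-monoˡ-≤ (d y a) (triangle x z y) ⟩
        d x z + d z y + d y a    ≡⟨ ℕ.+-assoc (d x z) (d z y) (d y a) ⟩
        d x z + (d z y + d y a)  ≤⟨ ℕ.+-monoʳ-≤ (d x z) (walkTo-via-≥ z y∈ys) ⟩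
        walkTo a d x (z ∷ ys)    ∎

-- Flips, as the discrete metric on `Bool`.

flip : Bool → Bool → ℕ
flip false false = 0
flip true  true  = 0
flip false true  = 1
flip true  false = 1

flip≤1 : ∀ b c → flip b c ℕ.≤ 1
flip≤1 false false = z≤n
flip≤1 true  true  = z≤n
flip≤1 false true  = s≤s z≤n
flip≤1 true  false = s≤s z≤n

flip-self : ∀ b → flip b b ≡ 0
flip-self false = refl
flip-self true  = refl

flip-triangle : ∀ b c d → flip b d ℕ.≤ flip b c + flip c d
flip-triangle false false d     = ℕ.≤-refl
flip-triangle true  true  d     = ℕ.≤-refl
flip-triangle false true  false = z≤n
flip-triangle false true  true  = s≤s z≤n
flip-triangle true  false true  = z≤n
flip-triangle true  false false = s≤s z≤n

-- Wherever the walk starts, one of `i` and `j` lies on the other side; going there costs at least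
-- one flip and coming back another.
closedWalk-flips-≥2 : ∀ {A : Set} (side : A → Bool) {k} (t : Fin (ℕ.suc k) → A) {i j} →
                      side (t i) ≡ false → side (t j) ≡ true →
                      2 ℕ.≤ walkTo (t zero) (λ x y → flip (side x) (side y)) (t zero) (tabulate (t ∘ suc))
closedWalk-flips-≥2 side t {i} {j} i-false j-true = byStart (side (t zero)) refl
  where
  flips = walkTo (t zero) (λ x y → flip (side x) (side y)) (t zero) (tabulate (t ∘ suc))

  there-and-back : ∀ i {b c} → side (t zero) ≡ b → side (t i) ≡ c → flip b c + flip c b ℕ.≤ flips
  -- The start is not among the tabulated stops, but here `b` and `c` coincide and the bound is 0.
  there-and-back zero {b} refl refl rewrite flip-self b = z≤n
  there-and-back (suc i) refl refl =
    walkTo-via-≥ (λ x y z → flip-triangle (side x) (side y) (side z)) (t zero) (∈-tabulate⁺ i)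

  byStart : ∀ b → side (t zero) ≡ b → 2 ℕ.≤ flips
  byStart false start-false = there-and-back j start-false j-true
  byStart true  start-true  = there-and-back i start-true i-false

-- Falsely implied paths against flips in a drawing.

module _ {n : ℕ} (G : Dag n) where
  open Dag G

  path⇒rank-< : (t : TopologicalSorting G) → ∀ {u v} → Path u v → rank t u Fin.< rank t v
  path⇒rank-< t [ e ]   = TopologicalSorting.monotone t e
  path⇒rank-< t (e ∷ p) = ℕ.<-trans (TopologicalSorting.monotone t e) (path⇒rank-< t p)

  rank-≤∧≢⇒< : (t : TopologicalSorting G) → ∀ {u v} → u ≢ v → rank t u Fin.≤ rank t v → rank t u Fin.< rank t v
  rank-≤∧≢⇒< t u≢v u≤v = Fin.≤∧≢⇒< u≤v (u≢v ∘ proj₁ (TopologicalSorting.bijective t))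

  -- Ranks are injective, so for distinct `u` and `v` the value `false` means that `t` puts `v`
  -- before `u`.
  side : Fin n × Fin n → TopologicalSorting G → Bool
  side (u , v) t = does (rank t u Fin.<? rank t v)

  incomparablePairs : List (Fin n × Fin n)
  incomparablePairs = filter (incomparable? G) (unorderedPairs n)

  -- On `incomparablePairs` this is the Kendall tau distance of `s` and `t`, since comparable pairs
  -- have the same order in all sortings.
  flips : List (Fin n × Fin n) → TopologicalSorting G → TopologicalSorting G → ℕ
  flips ps s t = sum (map (λ p → flip (side p s) (side p t)) ps)

  falselyImplied⇒incomparable : (Γ : WeakDominanceDrawing G) → ∀ {p} → FalselyImplied Γ p → Incomparable G p
  falselyImplied⇒incomparable (drawing s t) (u≢v , X≤ , _ , ¬uv) =
    u≢v , ¬uv , λ vu → ℕ.<⇒≱ (path⇒rank-< s vu) X≤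

  -- `fip` counts ordered pairs, whereas `incomparablePairs` lists each pair with the smaller index
  -- first. A falsely implied path appears there either as it is or swapped.
  fip-≤ : (Γ : WeakDominanceDrawing G) →
          fip Γ ℕ.≤ length (filter (falselyImplied? Γ) incomparablePairs) +
                    length (filter (falselyImplied? Γ ∘ swap) incomparablePairs)
  fip-≤ Γ = begin
    fip Γ                             ≤⟨ unique-⊆⇒length-≤ falselyImplied-unique sub ⟩
    length (ps ++ map swap qs)        ≡⟨ length-++ ps ⟩
    length ps + length (map swap qs)  ≡⟨ cong (λ l → length ps + l) (length-map swap qs) ⟩
    length ps + length qs             ∎
    where
    open ℕ.≤-Reasoning
    FI? = falselyImplied? Γ
    ps = filter FI? incomparablePairs
    qs = filter (FI? ∘ swap) incomparablePairs

    falselyImplied-unique : Unique (filter FI? (orderedPairs n))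
    falselyImplied-unique = Unique.filter⁺ FI? (Unique.cartesianProduct⁺ (Unique.allFin⁺ n) (Unique.allFin⁺ n))

    ∈-incomparablePairs : ∀ {u v} → u Fin.< v → Incomparable G (u , v) → (u , v) ∈ incomparablePairs
    ∈-incomparablePairs {u} {v} u<v u∥v =
      ∈-filter⁺ (incomparable? G)
        (∈-filter⁺ (λ (u , v) → u Fin.<? v) (∈-cartesianProduct⁺ (∈-allFin u) (∈-allFin v)) u<v) u∥v

    sub : filter FI? (orderedPairs n) ⊆ ps ++ map swap qs
    sub {u , v} uv∈ with proj₂ (∈-filter⁻ FI? {xs = orderedPairs n} uv∈)
    ... | fi with Fin.<-cmp u v | falselyImplied⇒incomparable Γ fi
    ...   | tri< u<v _ _ | u∥v = ∈-++⁺ˡ (∈-filter⁺ FI? (∈-incomparablePairs u<v u∥v) fi)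
    ...   | tri≈ _ u≡v _ | u≢v , _ = contradiction u≡v u≢v
    ...   | tri> _ _ v<u | u≢v , ¬uv , ¬vu = ∈-++⁺ʳ ps
      (∈-map⁺ swap (∈-filter⁺ (FI? ∘ swap) (∈-incomparablePairs v<u (u≢v ∘ sym , ¬vu , ¬uv)) fi))

  -- An incomparable pair that is falsely implied in either direction has the same order in `s` and
  -- `t`, hence does not flip, and it cannot be falsely implied in both directions.
  fip+flips-≤ : ∀ s t → fip {G = G} (drawing s t) + flips incomparablePairs s t ℕ.≤ inc G
  fip+flips-≤ s t = ℕ.≤-trans (ℕ.+-monoˡ-≤ _ (fip-≤ Γ))
    (filters+sum≤length (falselyImplied? Γ) (falselyImplied? Γ ∘ swap) _
      (λ { (u≢v , X≤ , _) (v≢u , X≥ , _) → ℕ.<⇒≱ (rank-≤∧≢⇒< s u≢v X≤) X≥ })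
      (λ p → flip≤1 (side p s) (side p t)) kept kept-swap incomparablePairs)
    where
    Γ : WeakDominanceDrawing G
    Γ = drawing s t

    kept : ∀ {p} → FalselyImplied Γ p → flip (side p s) (side p t) ≡ 0
    kept (u≢v , X≤ , Y≤ , _) = cong₂ flip
      (dec-true (_ Fin.<? _) (rank-≤∧≢⇒< s u≢v X≤)) (dec-true (_ Fin.<? _) (rank-≤∧≢⇒< t u≢v Y≤))

    kept-swap : ∀ {p} → FalselyImplied Γ (swap p) → flip (side p s) (side p t) ≡ 0
    kept-swap (_ , X≥ , Y≥ , _) = cong₂ flip
      (dec-false (_ Fin.<? _) (ℕ.≤⇒≯ X≥)) (dec-false (_ Fin.<? _) (ℕ.≤⇒≯ Y≥))

  -- The closed tour through the sortings of a dominance drawing.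

  module _ {k : ℕ} (D : DominanceDrawing G (ℕ.suc k)) where
    open DominanceDrawing D

    tour : (TopologicalSorting G → TopologicalSorting G → ℕ) → ℕ
    tour d = walkTo (sorting zero) d (sorting zero) (tabulate (sorting ∘ suc))

    -- Contrapositive of `path⇔<`; the witness exists because there are finitely many sortings and
    -- ranks are decidably ordered.
    reversing : ∀ {u v} → u ≢ v → ¬ Path u v → ∃ λ i → ¬ (rank (sorting i) u Fin.< rank (sorting i) v)
    reversing u≢v ¬uv = Fin.¬∀⟶∃¬ _ _ (λ i → _ Fin.<? _) (¬uv ∘ Equivalence.from (path⇔< u≢v))

    tour-flips-≥2 : ∀ {p} → Incomparable G p → 2 ℕ.≤ tour (λ s t → flip (side p s) (side p t))
    tour-flips-≥2 {p} (u≢v , ¬uv , ¬vu) =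
      -- The missing path from `u` to `v` provides a sorting with `v` first, the missing path from
      -- `v` to `u` one with `u` first.
      let i , u≮v = reversing u≢v ¬uv
          j , v≮u = reversing (u≢v ∘ sym) ¬vu
      in closedWalk-flips-≥2 (side p) sorting
           (dec-false (_ Fin.<? _) u≮v)
           (dec-true (_ Fin.<? _) (rank-≤∧≢⇒< (sorting j) u≢v (ℕ.≮⇒≥ v≮u)))

    -- Sums over pairs and along the tour are exchanged one pair at a time by `walkTo-+`.
    tour-flips-≥ : ∀ {ps} → All (Incomparable G) ps → 2 * length ps ℕ.≤ tour (flips ps)
    tour-flips-≥ [] = z≤n
    tour-flips-≥ {p ∷ ps} (p∥ ∷ ps∥) = begin
      2 * ℕ.suc (length ps)                                        ≡⟨ ℕ.*-suc 2 (length ps) ⟩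
      2 + 2 * length ps                                            ≤⟨ ℕ.+-mono-≤ (tour-flips-≥2 p∥) (tour-flips-≥ ps∥) ⟩
      tour (λ s t → flip (side p s) (side p t)) + tour (flips ps)  ≡⟨ walkTo-+ _ (flips ps) (sorting zero) (tabulate (sorting ∘ suc)) ⟨
      tour (flips (p ∷ ps))                                        ∎
      where open ℕ.≤-Reasoning

  -- Double counting and the integer bound.

  min-fip-≤ : ∀ Γ → min-fip G ℕ.≤ fip {G = G} Γ
  min-fip-≤ Γ = proj₂ (proj₂ (minimumFip G)) (Γ , refl)

  2*inc≤k*[inc∸min-fip] : ∀ {k} → 1 ℕ.≤ k → DominanceDrawing G k → 2 * inc G ℕ.≤ k * (inc G ∸ min-fip G)
  -- A single sorting is covered too: `rest` is then empty and the tour is one step from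
  -- `sorting zero` to itself.
  2*inc≤k*[inc∸min-fip] {ℕ.suc k} _ D = begin
    2 * inc G                         ≤⟨ tour-flips-≥ D all-incomparable ⟩
    tour D (flips incomparablePairs)  ≤⟨ walkTo-≤ flips-≤ (sorting zero) rest ⟩
    ℕ.suc (length rest) * bound       ≡⟨ cong (λ l → ℕ.suc l * bound) (length-tabulate (sorting ∘ suc)) ⟩
    ℕ.suc k * bound                   ∎
    where
    open ℕ.≤-Reasoning
    open DominanceDrawing D
    bound = inc G ∸ min-fip G
    rest  = tabulate (sorting ∘ suc)

    all-incomparable : All (Incomparable G) incomparablePairs
    all-incomparable = All.tabulate (proj₂ ∘ ∈-filter⁻ (incomparable? G) {xs = unorderedPairs n})

    flips-≤ : ∀ s t → flips incomparablePairs s t ℕ.≤ bound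
    flips-≤ s t = ℕ.m+n≤o⇒m≤o∸n (flips incomparablePairs s t) (begin
      flips incomparablePairs s t + min-fip G          ≤⟨ ℕ.+-monoʳ-≤ _ (min-fip-≤ Γ) ⟩
      flips incomparablePairs s t + fip Γ              ≡⟨ ℕ.+-comm _ (fip Γ) ⟩
      fip Γ + flips incomparablePairs s t              ≤⟨ fip+flips-≤ s t ⟩
      inc G                                            ∎)
      where
      Γ : WeakDominanceDrawing G
      Γ = drawing s t

  -- Guarantees that the truncated difference `inc G ∸ min-fip G` is the true one, so that the bound
  -- can be moved to the integers.
  min-fip≤inc : min-fip G ℕ.≤ inc G
  min-fip≤inc with Γ , _ ← proj₁ (proj₂ (minimumFip G)) =
    ℕ.≤-trans (min-fip-≤ Γ) (ℕ.m+n≤o⇒m≤o _ (fip+flips-≤ (WeakDominanceDrawing.t-X Γ) (WeakDominanceDrawing.t-Y Γ)))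

lemma2 : ∀ {n : ℕ} (G : Dag n) →
    + min-fip G ≤ + inc G - ⌈ + (2 * inc G) / dim G ⌉
lemma2 G = begin
  -- Writing the minimum as `inc G` minus `m` reduces the goal to bounding the ceiling by the
  -- integer `m`.
  + min-fip G                          ≡⟨ cong +_ (ℕ.m∸[m∸n]≡n (min-fip≤inc G)) ⟨
  + (inc G ∸ m)                        ≡⟨ ℤ.⊖-≥ (ℕ.m∸n≤m (inc G) (min-fip G)) ⟨
  inc G ℤ.⊖ m                          ≡⟨ ℤ.m-n≡m⊖n (inc G) m ⟨
  + inc G - + m                        ≤⟨ ℤ.+-monoʳ-≤ (+ inc G) (ℤ.neg-mono-≤ (⌈/⌉-≤ (+ (2 * inc G)) (dim G) (+ m) bound)) ⟩
  + inc G - ⌈ + (2 * inc G) / dim G ⌉  ∎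
  where
  open ℤ.≤-Reasoning
  m = inc G ∸ min-fip G

  bound : + (2 * inc G) ≤ + m ℤ.* + dim G
  bound = let 1≤k , D = proj₁ (proj₂ (dimension G)) in begin
    + (2 * inc G)      ≤⟨ ℤ.+≤+ (2*inc≤k*[inc∸min-fip] G 1≤k D) ⟩
    + (dim G * m)      ≡⟨ cong +_ (ℕ.*-comm (dim G) m) ⟩
    + (m * dim G)      ≡⟨ ℤ.pos-* m (dim G) ⟩
    + m ℤ.* + dim G    ∎
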